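{- Let $C=(X,\xi)$ be a finite $T$-coalgebra. For every $x\in X$ there exists a closed and guarded expression $\phi\in\mathcal{E}_0$ such that $x\in[\![\phi]\!]_C$.
   Context: Standing assumptions: $T:\mathbf{Set}\to\mathbf{Set}$ is a functor; $\mathcal{L}$ is a set of modalities with arities ($L/n$), each $L/n$ assigned an $n$-ary monotone singleton-preserving predicate lifting $[\![L]\!]$ for $T$ such that $\Lambda=\{[\![L]\!]\mid L\in\mathcal{L}\}$ is strongly expressive. (An $n$-ary predicate lifting is a family $\lambda_X:(\mathcal{P}X)^n\to\mathcal{P}(TX)$ with $\lambda_X(f^{ -1}[A_1],\dots,f^{ -1}[A_n])=(Tf)^{ -1}[\lambda_Y(A_1,\dots,A_n)]$ for $f:X\to Y$; monotone if monotone in each argument; singleton-preserving if $|\lambda_X(\{x_1\},\dots,\{x_n\})|=1$ for all $x_i\in X$; $\Lambda$ strongly expressive if for every set $X$ and $t\in TX$ there are $\lambda/n\in\Lambda$, $x_i\in X$ with $\{t\}=\lambda_X(\{x_1\},\dots,\{x_n\})$.) Fix a set $V$ of variables. Expressions $\mathcal{E}$: $\phi::=z\mid\nu z.\,\phi\mid L(\phi_1,\dots,\phi_n)$. Closed: every variable occurrence bound by a $\nu$. Guarded: every variable occurrence is separated from its binding $\nu$ by at least one modality. $\mathcal{E}_0$ is the set of closed guarded expressions. Semantics in a coalgebra $C=(X,\xi)$ under valuation $\kappa:V\to\mathcal{P}X$: $[\![z]\!]^\kappa=\kappa(z)$; $[\![L(\phi_1,\dots,\phi_n)]\!]^\kappa=\xi^{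 -1}[[\![L]\!]_X([\![\phi_1]\!]^\kappa,\dots,[\![\phi_n]\!]^\kappa)]$; $[\![\nu z.\phi]\!]^\kappa=$ greatest fixed point of $Y\mapsto[\![\phi]\!]^{\kappa[z\mapsto Y]}$; for closed $\phi$ write $[\![\phi]\!]_C$.
   Formalization: The set V of variables is assumed to be infinite, the usual convention of an unlimited supply of variables; for an arbitrary set V the claim fails, for example for empty V and the identity functor with one unary modality, where no closed expression exists. -}

module Defs where

open import Axiom.ExcludedMiddle using (ExcludedMiddle)
open import Data.Fin.Base using (Fin)
open import Data.Nat.Base using (ℕ)
open import Data.Product.Base using (Σ-syntax; ∃-syntax; _×_; _,_)
open import Data.Vec.Functional using (Vector)
open import Effect.Functor using (RawFunctor)
open import Function.Base using (_∘_; id)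
open import Function.Bundles using (_↔_; _↣_)
open import Level using (0ℓ; Lift; lift; lower) renaming (suc to lsuc)
open import Relation.Binary.PropositionalEquality using (_≡_; _≢_; _≗_)
open import Relation.Nullary.Decidable using (yes; no; map′; True; toWitness; fromWitness)
open import Relation.Nullary.Negation using (¬_; contradiction)
open import Relation.Unary using (Pred; _∈_; _⊆_; _≐_; _⊢_; ｛_｝; ∅)

𝒫 : Set → Set₁
𝒫 X = Pred X 0ℓ

Finite : Set → Set
Finite X = ∃[ n ] (X ↔ Fin n)

Infinite : Set → Set
Infinite X = ℕ ↣ X

-- Functions are compared pointwise.  In set theory <$>-cong is automatic;
-- without function extensionality it is part of being a functor on sets.
record SetFunctor : Set₁ where
  field
    T          : Set → Set
    rawFunctor : RawFunctor T
  open RawFunctor rawFunctor public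
  field
    <$>-cong : ∀ {X Y : Set} {f g : X → Y} → f ≗ g → (f <$>_) ≗ (g <$>_)
    <$>-id   : ∀ {X : Set} → (id {A = X} <$>_) ≗ id
    <$>-∘    : ∀ {X Y Z : Set} (g : Y → Z) (f : X → Y) →
               ((g ∘ f) <$>_) ≗ (g <$>_) ∘ (f <$>_)

record PredicateLifting (F : SetFunctor) (n : ℕ) : Set₁ where
  open SetFunctor F
  field
    _on_    : (X : Set) → Vector (𝒫 X) n → 𝒫 (T X)
    natural : ∀ {X Y : Set} (f : X → Y) (A : Vector (𝒫 Y) n) →
              (_on_ X (λ i → f ⊢ A i)) ≐ ((f <$>_) ⊢ _on_ Y A)

open PredicateLifting public using (_on_)

module _ {F : SetFunctor} where
  open SetFunctor F using (T)

  Monotone : ∀ {n} → PredicateLifting F n → Set₁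
  Monotone {n} l = ∀ (X : Set) (A B : Vector (𝒫 X) n) →
    (∀ i → A i ⊆ B i) → (l on X) A ⊆ (l on X) B

  SingletonPreserving : ∀ {n} → PredicateLifting F n → Set₁
  SingletonPreserving {n} l = ∀ (X : Set) (x : Vector X n) →
    ∃[ t ] (l on X) (λ i → ｛ x i ｝) ≐ ｛ t ｝

record Modalities (F : SetFunctor) : Set₁ where
  field
    ℒ    : Set
    ar   : ℒ → ℕ
    ⟦_⟧ᴸ : (L : ℒ) → PredicateLifting F (ar L)

StronglyExpressive : {F : SetFunctor} → Modalities F → Set₁
StronglyExpressive {F} M = ∀ (X : Set) (t : T X) →
  Σ[ L ∈ ℒ ] Σ[ x ∈ Vector X (ar L) ] ｛ t ｝ ≐ (⟦ L ⟧ᴸ on X) (λ i → ｛ x i ｝)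
  where
  open SetFunctor F using (T)
  open Modalities M

record Coalgebra (F : SetFunctor) : Set₁ where
  open SetFunctor F using (T)
  field
    X : Set
    ξ : X → T X

module Expressions {F : SetFunctor} (M : Modalities F) (V : Set) where
  open Modalities M using (ℒ; ar)

  data Expr : Set where
    var : V → Expr
    ν   : V → Expr → Expr
    mod : (L : ℒ) → Vector Expr (ar L) → Expr

  data _FreeIn_ (z : V) : Expr → Set where
    var : z FreeIn var z
    ν   : ∀ {w φ} → z ≢ w → z FreeIn φ → z FreeIn ν w φ
    mod : ∀ {L φs} i → z FreeIn φs i → z FreeIn mod L φs

  -- z has a free occurrence that lies under no modality.
  data _UnguardedIn_ (z : V) : Expr → Set where
    var : z UnguardedIn var z
    ν   : ∀ {w φ} → z ≢ w → z UnguardedIn φ → z UnguardedIn ν w φ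

  Closed : Expr → Set
  Closed φ = ∀ z → ¬ (z FreeIn φ)

  data Guarded : Expr → Set where
    var : ∀ z → Guarded (var z)
    ν   : ∀ {z φ} → ¬ (z UnguardedIn φ) → Guarded φ → Guarded (ν z φ)
    mod : ∀ {L φs} → (∀ i → Guarded (φs i)) → Guarded (mod L φs)

  𝓔₀ : Pred Expr 0ℓ
  𝓔₀ φ = Closed φ × Guarded φ

-- Excluded middle makes up for two things that a predicative, constructive
-- theory lacks: the union of all postfixed points, which quantifies over 𝒫 X,
-- is again a (small) element of 𝒫 X, and valuations can be updated at a variable.
module Semantics (em : ExcludedMiddle (lsuc 0ℓ)) where

  em₀ : ExcludedMiddle 0ℓ
  em₀ = map′ lower lift (em {P = Lift (lsuc 0ℓ) _})

  gfp : {X : Set} → (𝒫 X → 𝒫 X) → 𝒫 X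
  gfp {X} f x = True (em {P = Σ[ Y ∈ 𝒫 X ] Y ⊆ f Y × x ∈ Y})

  gfp-coinduction : ∀ {X : Set} (f : 𝒫 X → 𝒫 X) {Y : 𝒫 X} → Y ⊆ f Y → Y ⊆ gfp f
  gfp-coinduction f {Y} Y⊆fY y∈Y = fromWitness (Y , (λ {x} → Y⊆fY {x}) , y∈Y)

  gfp-fixed : ∀ {X : Set} (f : 𝒫 X → 𝒫 X) →
              (∀ {Y Z : 𝒫 X} → Y ⊆ Z → f Y ⊆ f Z) → gfp f ≐ f (gfp f)
  gfp-fixed f mono = postfixed , gfp-coinduction f (mono postfixed)
    where
    postfixed : gfp f ⊆ f (gfp f)
    postfixed x∈ with toWitness x∈
    ... | Y , Y⊆fY , x∈Y = mono (gfp-coinduction f Y⊆fY) (Y⊆fY x∈Y)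

  module _ {F : SetFunctor} (M : Modalities F) (V : Set) (C : Coalgebra F) where
    open Modalities M using (⟦_⟧ᴸ)
    open Expressions M V
    open Coalgebra C

    Valuation : Set₁
    Valuation = V → 𝒫 X

    _[_↦_] : Valuation → V → 𝒫 X → Valuation
    (κ [ z ↦ Y ]) w with em₀ {P = w ≡ z}
    ... | yes _ = Y
    ... | no  _ = κ w

    ⟦_⟧ : Expr → Valuation → 𝒫 X
    ⟦ var z ⟧    κ = κ z
    ⟦ ν z φ ⟧    κ = gfp (λ Y → ⟦ φ ⟧ (κ [ z ↦ Y ]))
    ⟦ mod L φs ⟧ κ = ξ ⊢ (⟦ L ⟧ᴸ on X) (λ i → ⟦ φs i ⟧ κ)

    -- Used for closed expressions only; there the choice of the valuation is
    -- irrelevant (⟦⟧-closed below).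
    ⟦_⟧꜀ : Expr → 𝒫 X
    ⟦ φ ⟧꜀ = ⟦ φ ⟧ (λ _ → ∅)

    module _ (monotone : ∀ L → Monotone (⟦ L ⟧ᴸ)) where

      ⟦⟧-mono : ∀ φ {κ κ′ : Valuation} → (∀ z → z FreeIn φ → κ z ⊆ κ′ z) →
                ⟦ φ ⟧ κ ⊆ ⟦ φ ⟧ κ′
      ⟦⟧-mono (var z) h = h z var
      ⟦⟧-mono (mod L φs) h =
        monotone L X _ _ (λ i → ⟦⟧-mono (φs i) (λ z z∈ → h z (mod i z∈)))
      ⟦⟧-mono (ν z φ) {κ} {κ′} h x∈ with toWitness x∈
      ... | Y , Y⊆ , x∈Y = gfp-coinduction _ (λ y∈ → ⟦⟧-mono φ step (Y⊆ y∈)) x∈Y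
        where
        step : ∀ w → w FreeIn φ → (κ [ z ↦ Y ]) w ⊆ (κ′ [ z ↦ Y ]) w
        step w w∈ with em₀ {P = w ≡ z}
        ... | yes _   = id
        ... | no  w≢z = h w (ν w≢z w∈)

      ⟦⟧-closed : ∀ {φ} → Closed φ → ∀ κ → ⟦ φ ⟧ κ ≐ ⟦ φ ⟧꜀
      ⟦⟧-closed {φ} cl κ =
        ⟦⟧-mono φ (λ z z∈ → contradiction z∈ (cl z)) ,
        ⟦⟧-mono φ (λ z z∈ → contradiction z∈ (cl z))

      ν-fixed : ∀ z φ κ → ⟦ ν z φ ⟧ κ ≐ ⟦ φ ⟧ (κ [ z ↦ ⟦ ν z φ ⟧ κ ])
      ν-fixed z φ κ = gfp-fixed _ (λ {Y} {Z} Y⊆Z → ⟦⟧-mono φ (step Y⊆Z))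
        where
        step : ∀ {Y Z : 𝒫 X} → Y ⊆ Z →
               ∀ w → w FreeIn φ → (κ [ z ↦ Y ]) w ⊆ (κ [ z ↦ Z ]) w
        step Y⊆Z w _ with em₀ {P = w ≡ z}
        ... | yes _ = Y⊆Z
        ... | no  _ = id

{-# OPTIONS --safe #-}

-- Unfold C from x, binding one variable per state along each branch: a state y
-- already bound on the current branch becomes its variable, any other y becomes
-- ν z_y. L(φ₁, …, φₙ), where strong expressiveness gives {ξ y} = ⟦L⟧({y₁}, …, {yₙ})
-- and φᵢ unfolds yᵢ.  Finiteness bounds the depth.  Each such fixed point contains
-- y because {y} is a postfixed point, by monotonicity of L.
module Submission where

open import Defs
open import Axiom.ExcludedMiddle using (ExcludedMiddle)
open import Data.Fin.Base using (Fin; toℕ)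
open import Data.Fin.Properties using (toℕ-injective)
open import Data.Fin.Subset as Subset using (Subset; ⊤; _-_; _⊂_)
open import Data.Fin.Subset.Induction using (⊂-wellFounded)
open import Data.Fin.Subset.Properties using (_∈?_; ∈⊤; x∈p⇒p-x⊂p; x∈p∧x≢y⇒x∈p-y)
open import Data.Nat.Base using (ℕ)
open import Data.Product.Base using (Σ-syntax; ∃-syntax; _×_; _,_; proj₁; proj₂)
open import Function.Base using (_∘_)
open import Function.Bundles using (_↔_; Inverse; Injection)
open import Function.Definitions using (Injective)
open import Function.Properties.Inverse using (↔⇒↣)
open import Induction.WellFounded using (Acc; acc)
open import Level using (0ℓ) renaming (suc to lsuc)
open import Relation.Binary.PropositionalEquality using (_≡_; _≢_; refl; sym; cong)
open import Relation.Nullary.Decidable using (yes; no)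
open import Relation.Nullary.Negation using (contradiction)
open import Relation.Unary using (_∈_; ｛_｝)

module Unfolding
  (em : ExcludedMiddle (lsuc 0ℓ))
  {F : SetFunctor} (M : Modalities F)
  (monotone : ∀ L → Monotone (Modalities.⟦_⟧ᴸ M L))
  (expressive : StronglyExpressive M)
  (V : Set) (C : Coalgebra F)
  {n : ℕ} (X↔Fin : Coalgebra.X C ↔ Fin n)
  (name : Coalgebra.X C → V) (name-injective : Injective _≡_ _≡_ name)
  where

  open Coalgebra C
  open Modalities M
  open Expressions M V
  open Semantics em
  open Inverse X↔Fin using () renaming (to to index)

  index-injective : Injective _≡_ _≡_ index
  index-injective = Injection.injective (↔⇒↣ X↔Fin)

  -- R is the set of states not yet bound on the current branch; it shrinks.
  _BoundOutside_ : X → Subset n → Set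
  x BoundOutside R = index x Subset.∉ R

  -- The premise compares names because the free-variable rule of `ν` and the valuation update both
  -- yield an inequality of names; equal indices would force equal states, hence equal names.
  still-bound : ∀ {R x y} → y BoundOutside (R - index x) → name y ≢ name x →
                y BoundOutside R
  still-bound y∉ y≢x y∈R =
    y∉ (x∈p∧x≢y⇒x∈p-y y∈R (y≢x ∘ cong name ∘ index-injective))

  -- The induction invariant. `sound` ranges over all such `κ` because a child is evaluated after
  -- `name x` has been reset to `｛ x ｝`.
  record Unfolds (R : Subset n) (x : X) : Set₁ where
    field
      expr    : Expr
      guarded : Guarded expr
      free    : ∀ z → z FreeIn expr → ∃[ y ] y BoundOutside R × z ≡ name y
      sound   : ∀ κ → (∀ y → y BoundOutside R → y ∈ κ (name y)) → x ∈ ⟦_⟧ M V C expr κ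
  open Unfolds

  unfold : ∀ {R} → Acc _⊂_ R → ∀ x → Unfolds R x
  unfold {R} (acc rec) x with index x ∈? R
  ... | no x∉R = record
    { expr    = var (name x)
    ; guarded = var (name x)
    ; free    = λ { _ var → x , x∉R , refl }
    ; sound   = λ _ bound → bound x x∉R
    }
  ... | yes x∈R with expressive X (ξ x)
  ...   | L , xs , ξx⊆L , _ = record
    { expr    = ν (name x) (mod L (expr ∘ child))
    -- The body of this `ν` starts with a modality, so no variable is unguarded in it.
    ; guarded = ν (λ ()) (mod (guarded ∘ child))
    ; free    = λ { z (ν z≢ (mod i z∈)) → free-child z z≢ (free (child i) z z∈) }
    ; sound   = λ κ bound →
        gfp-coinduction _ {｛ x ｝}
          -- Each singleton `｛ xs i ｝` is enlarged to the meaning of its child.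
          (λ { refl → monotone L X _ _
                 (λ { i refl → sound (child i) _ (extend κ bound) })
                 (ξx⊆L refl) })
          refl
    }
    where
    child : ∀ i → Unfolds (R - index x) (xs i)
    child i = unfold (rec (x∈p⇒p-x⊂p x∈R)) (xs i)

    free-child : ∀ z → z ≢ name x →
                 ∃[ y ] y BoundOutside (R - index x) × z ≡ name y →
                 ∃[ y ] y BoundOutside R × z ≡ name y
    free-child z z≢ (y , y∉ , refl) = y , still-bound y∉ z≢ , refl

    extend : ∀ κ → (∀ y → y BoundOutside R → y ∈ κ (name y)) →
             ∀ y → y BoundOutside (R - index x) →
             y ∈ _[_↦_] M V C κ (name x) ｛ x ｝ (name y)
    extend κ bound y y∉ with em₀ {P = name y ≡ name x}
    -- Distinct states never share a variable, so the reset of `name x` concerns `x` alone.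
    ... | yes y≡x = sym (name-injective y≡x)
    ... | no  y≢x = bound y (still-bound y∉ y≢x)

mainTheorem12 : (em : ExcludedMiddle (lsuc 0ℓ))
    (F : SetFunctor) (M : Modalities F) →
    (∀ L → Monotone (Modalities.⟦_⟧ᴸ M L)) →
    (∀ L → SingletonPreserving (Modalities.⟦_⟧ᴸ M L)) →
    StronglyExpressive M →
    (V : Set) → Infinite V →
    (C : Coalgebra F) → Finite (Coalgebra.X C) →
    (x : Coalgebra.X C) →
    Σ[ φ ∈ Expressions.Expr M V ]
    φ ∈ Expressions.𝓔₀ M V × x ∈ Semantics.⟦_⟧꜀ em M V C φ
mainTheorem12 em F M monotone _ expressive V ℕ↣V C (n , X↔Fin) x =
  expr u ,
  ((λ z z∈ → proj₁ (proj₂ (free u z z∈)) ∈⊤) , guarded u) ,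
  sound u _ (λ _ y∉⊤ → contradiction ∈⊤ y∉⊤)
  where
  open Unfolding em M monotone expressive V C X↔Fin
    (Injection.to ℕ↣V ∘ toℕ ∘ Inverse.to X↔Fin)
    (Injection.injective (↔⇒↣ X↔Fin) ∘ toℕ-injective ∘ Injection.injective ℕ↣V)
  open Unfolds
  -- At `⊤` no state counts as bound: `free` then gives closedness, and the condition of `sound` on
  -- `κ` is vacuous.
  u = unfold (⊂-wellFounded ⊤) x
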